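{- Consider an instance of $k$-robust minimum cut: undirected graph $G=(V,E)$ with edge costs $c\ge0$, root $r$, terminals $U\subseteq V$, inflation $\lambda\ge1$, integer $k\ge1$. Fix an optimal solution; let $\Phi^*$ denote its first-stage edge set (and its cost) and $T^*$ its second-stage cost $\max_{|D|=k}c(E_D)$. Let $\beta\ge\frac{10e}{e-1}$, $T\ge T^*$, and let $S$ be the set of terminals $v\in U$ for which the minimum cost of an edge set separating $v$ from $r$ in $G$ is at least $\beta\cdot T/k$. Then the minimum cost of an edge set whose removal separates every vertex of $S$ from $r$ is at most $3\,\Phi^*+\frac{\beta}{2}T^*$.
   Context: $k$-robust minimum cut: a feasible solution consists of a first-stage edge set $E_0\subseteq E$ and, for every $D\subseteq U$ with $|D|=k$, an edge set $E_D$ such that no vertex of $D$ is connected to $r$ in $G\setminus(E_0\cup E_D)$; its cost is $c(E_0)+\lambda\max_{|D|=k}c(E_D)$.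
   Formalization: The edge costs c, the inflation λ, β and T are taken to be rational; β ≥ 10e/(e−1) is expressed, equivalently for rational β, through partial sums of Σ1/i!; k ≤ |U| is assumed so that the maximum over |D|=k is over a non-empty family. -}

module Defs where

open import Data.Nat as ℕ using (ℕ; zero; suc)
open import Data.Nat.Properties using (_!≢0)
open import Data.Nat using (_!)
open import Data.Integer using (+_)
open import Data.Rational using (ℚ; 0ℚ; 1ℚ; _+_; _*_; _≤_; _⊔_; _/_)
open import Data.Fin using (Fin; zero; suc)
open import Data.Fin.Subset using (Subset; _∈_; _∉_; _⊆_; _∪_; ∣_∣)
open import Data.Fin.Subset.Properties using (_⊆?_)
open import Data.Vec using ([]; _∷_)
open import Data.Bool using (Bool; true; false; if_then_else_; _∧_)
open import Data.List using (List; []; _∷_; map; _++_; foldr)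
open import Data.Product using (_×_; Σ; _,_)
open import Data.Sum using (_⊎_)
open import Relation.Nullary using (¬_)
open import Relation.Nullary.Decidable using (⌊_⌋)
open import Relation.Binary.PropositionalEquality using (_≡_)

-- An undirected (multi)graph with vertex set Fin n and edge set Fin m;
-- edge e joins end₁ e and end₂ e.
record Graph (n m : ℕ) : Set where
  field
    end₁ : Fin m → Fin n
    end₂ : Fin m → Fin n
open Graph public

data Conn {n m : ℕ} (G : Graph n m) (F : Subset m) (u : Fin n) : Fin n → Set where
  here : Conn G F u u
  step : ∀ {w v} (e : Fin m) → e ∉ F →
         (end₁ G e ≡ w × end₂ G e ≡ v) ⊎ (end₂ G e ≡ w × end₁ G e ≡ v) →
         Conn G F u w → Conn G F u v

cost : ∀ {m} → (Fin m → ℚ) → Subset m → ℚ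
cost {zero}  c []            = 0ℚ
cost {suc m} c (true  ∷ F)   = c zero + cost (λ e → c (suc e)) F
cost {suc m} c (false ∷ F)   = cost (λ e → c (suc e)) F

Separates : ∀ {n m} → Graph n m → Fin n → Subset m → Subset n → Set
Separates G r F X = ∀ v → v ∈ X → ¬ Conn G F r v

allSubsets : ∀ n → List (Subset n)
allSubsets zero    = [] ∷ []
allSubsets (suc n) = map (true ∷_) (allSubsets n) ++ map (false ∷_) (allSubsets n)

isScenario : ∀ {n} → Subset n → ℕ → Subset n → Bool
isScenario U k D = ⌊ D ⊆? U ⌋ ∧ ⌊ ∣ D ∣ ℕ.≟ k ⌋

-- A solution: first-stage set E₀ and second-stage sets E_D for every D.
Solution : ℕ → ℕ → Set
Solution n m = Subset m × (Subset n → Subset m)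

Feasible : ∀ {n m} → Graph n m → Fin n → Subset n → ℕ → Solution n m → Set
Feasible G r U k (E₀ , E) =
  ∀ D → D ⊆ U → ∣ D ∣ ≡ k → Separates G r (E₀ ∪ E D) D

-- Second-stage cost max_{D ⊆ U, |D| = k} c(E_D)  (0 if there is no scenario;
-- costs are nonnegative so 0 is a neutral base for the maximum).
secondStage : ∀ {n m} → (Fin m → ℚ) → Subset n → ℕ → (Subset n → Subset m) → ℚ
secondStage {n} c U k E =
  foldr (λ D acc → (if isScenario U k D then cost c (E D) else 0ℚ) ⊔ acc) 0ℚ (allSubsets n)

totalCost : ∀ {n m} → (Fin m → ℚ) → Subset n → ℕ → ℚ → Solution n m → ℚ
totalCost c U k λ' (E₀ , E) = cost c E₀ + λ' * secondStage c U k E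

Optimal : ∀ {n m} → Graph n m → (Fin m → ℚ) → Fin n → Subset n → ℕ → ℚ → Solution n m → Set
Optimal G c r U k λ' sol =
  Feasible G r U k sol ×
  (∀ sol' → Feasible G r U k sol' → totalCost c U k λ' sol ≤ totalCost c U k λ' sol')

eSum : ℕ → ℚ
eSum zero    = 1ℚ
eSum (suc N) = eSum N + ((+ 1) / (suc N !)) {{suc N !≢0}}

-- β ≥ 10e/(e-1) for rational β.  Since 10e/(e-1) is irrational, this holds iff
-- β > 10e/(e-1) iff some partial sum s = eSum N satisfies 10 s/(s-1) ≤ β,
-- written with the (positive) denominator cleared: 10·s ≤ β·(s-1).
BetaCondition : ℚ → Set
BetaCondition β = Σ ℕ (λ N → (+ 10 / 1) * eSum N ≤ β * (eSum N Data.Rational.- 1ℚ))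

{-# OPTIONS --safe #-}

-- Let δ be the cut function of G without the first-stage edges, t the second-stage cost, Φ the
-- first-stage cost and ε = t/k.  Enlarge a terminal set D ⊆ S greedily while some terminal raises the
-- minimum δ-cut of D by more than ε.  Cuts of k terminals cost at most t, so this stops with a minimum
-- cut A, δ A ≤ t, such that every v ∈ S lies in some B ⊇ A avoiding r with δ B ≤ δ A + ε.  Take an
-- irredundant family of q such sets covering S \ A.  The parts Pᵢ of Bᵢ covered exactly once are disjoint
-- and contain a terminal each, so each costs at least βt/k in G.  Submodularity gives
-- Σ δ(Pᵢ) ≤ 2 δ A + qε, and the first-stage edges add at most 2Φ; as β ≥ 3 this forces qε ≤ t + Φ.
-- The union of the Bᵢ costs at most δ A + qε + Φ ≤ 2Φ + 2t.
module Submission where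

open import Defs
open import Data.Nat as ℕ using (ℕ; zero; suc; NonZero; z≤n; s≤s; _!)
open import Data.Nat.Properties using (_!≢0)
import Data.Nat.Properties as ℕ
import Data.Nat.Solver as ℕ
open import Data.Rational using (ℚ; 0ℚ; 1ℚ; _+_; _*_; -_; _-_; _≤_; _<_; _/_; _⊔_;
  NonNegative; nonNegative; fromℚᵘ; toℚᵘ)
import Data.Rational.Properties as ℚ
import Data.Rational.Solver as ℚ
open import Relation.Binary.Bundles using (DecTotalOrder)
open import Algebra.Properties.CommutativeMonoid.Mult ℚ.+-0-commutativeMonoid
  using (×-homo-+; ×-distrib-+) renaming (_×_ to _·_)
open import Algebra.Properties.CommutativeMonoid.Sum ℚ.+-0-commutativeMonoid
  using (sum; ∑-distrib-+; sum-cong-≗; sum-replicate-zero)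
open import Algebra.Properties.CommutativeMonoid.Sum ℕ.+-0-commutativeMonoid
  using () renaming (sum to sumℕ; sum-cong-≗ to sumℕ-cong-≗)
open import Data.Bool using (Bool; T; true; false; _∧_; _∨_; not; _xor_; if_then_else_)
open import Data.Bool.Properties using (T?; xor-same)
open import Data.Empty using (⊥-elim)
open import Data.Fin as Fin using (Fin; zero; suc; punchIn; punchOut)
open import Data.Fin.Properties using (any?; all?; punchIn-punchOut; ¬∀⟶∃¬)
open import Data.Fin.Subset using (Subset; inside; outside; _∈_; _∉_; _⊆_; _∪_; _∩_; ∁; ⊥; ⁅_⁆; ∣_∣)
open import Data.Fin.Subset.Properties
open import Data.Integer as ℤ using (+_)
import Data.Integer.Properties as ℤ
import Data.Integer.Solver as ℤ
open import Data.List as List using (filter)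
open import Data.List.Extrema (DecTotalOrder.totalOrder ℚ.≤-decTotalOrder)
  using (argmin; argmin-all; f[argmin]≤f[xs])
open import Data.List.Membership.Propositional using () renaming (_∈_ to _∈ˡ_)
open import Data.List.Membership.Propositional.Properties using (∈-map⁺; ∈-++⁺ˡ; ∈-++⁺ʳ; ∈-filter⁺)
import Data.List.Relation.Unary.All as All
open import Data.List.Relation.Unary.All.Properties using (all-filter)
import Data.List.Relation.Unary.Any as Any
open import Data.Product using (Σ; _×_; _,_; ∃; proj₁; proj₂)
open import Data.Sum using (_⊎_; inj₁; inj₂; [_,_]′)
import Data.Rational.Unnormalised as ℚᵘ
import Data.Rational.Unnormalised.Properties as ℚᵘ
open import Data.Vec as Vec using ([]; _∷_; lookup; tabulate)
open import Data.Vec.Functional using (tail)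
open import Data.Vec.Properties using (lookup-zipWith; lookup-map; lookup∘tabulate; []=⇒lookup; lookup⇒[]=)
open import Function using (_∘_; id; mk⇔)
open import Relation.Binary.PropositionalEquality
open import Relation.Nullary using (¬_; Dec; yes; no; contradiction)
open import Relation.Nullary.Decidable using (True; toWitness; map′; ¬?; does;
  dec-true; dec-false; does-⇔; ¬¬-excluded-middle;
  _×-dec_; _→-dec_; decidable-stable)
open import Relation.Unary using (Decidable)


-- Boolean inequalities for a single edge.

∀ᵇ? : {P : Bool → Set} → (∀ b → Dec (P b)) → Dec (∀ b → P b)
∀ᵇ? P? = map′ (λ { (f , t) false → f ; (f , t) true → t }) (λ p → p false , p true)
              (P? false ×-dec P? true)

-- Settles the edge inequalities below by evaluating them under every truth assignment during type
-- checking.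
decide : {P : Set} (P? : Dec P) → {True P?} → P
decide P? {t} = toWitness t

bit : Bool → ℕ
bit b = if b then 1 else 0

-- In the lemmas on bits, u and m say whether an endpoint of an edge is covered at least
-- once and at least twice by the family, primes refer to the other endpoint, and j says that both
-- endpoints are covered exactly once, by the same member.  The potential of the edge is its share of
-- δ(cover) + δ(multi) + 2 Σ_{i<j} δ(Pᵢ,Pⱼ).

once : Bool → Bool → Bool
once u m = u ∧ not m

potential : (u u′ m m′ j : Bool) → ℕ
potential u u′ m m′ j =
  bit (u xor u′) ℕ.+ bit (m xor m′) ℕ.+ 2 ℕ.* bit (once u m ∧ once u′ m′ ∧ not j)

valid : (u u′ m m′ j : Bool) → Bool
valid u u′ m m′ j = (not m ∨ u) ∧ (not m′ ∨ u′) ∧ (not j ∨ (once u m ∧ once u′ m′))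

sameStep : (u u′ b b′ j : Bool) → Bool
sameStep u u′ b b′ j = (b ∧ b′ ∧ not u ∧ not u′) ∨ (not b ∧ not b′ ∧ j)

valid-start : ∀ a a′ → T (valid a a′ a a′ false)
valid-start = decide (∀ᵇ? λ a → ∀ᵇ? λ a′ → T? _)

valid-step : ∀ u u′ m m′ j b b′ → T (valid u u′ m m′ j) →
  T (valid (b ∨ u) (b′ ∨ u′) (m ∨ (b ∧ u)) (m′ ∨ (b′ ∧ u′)) (sameStep u u′ b b′ j))
valid-step = decide (∀ᵇ? λ u → ∀ᵇ? λ u′ → ∀ᵇ? λ m → ∀ᵇ? λ m′ → ∀ᵇ? λ j → ∀ᵇ? λ b → ∀ᵇ? λ b′ →
  T? _ →-dec T? _)

potential-start : ∀ a a′ → potential a a′ a a′ false ℕ.≤ bit (a xor a′) ℕ.+ bit (a xor a′)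
potential-start = decide (∀ᵇ? λ a → ∀ᵇ? λ a′ → _ ℕ.≤? _)

-- Two uncrossings in one: `u` with `b`, then `m` with `b ∧ u`, whose intersection is `m ∧ b`
-- because validity makes `m` imply `u`. Their slack pays for edges that now join two different
-- private parts.
potential-step : ∀ u u′ m m′ j b b′ → T (valid u u′ m m′ j) →
  potential (b ∨ u) (b′ ∨ u′) (m ∨ (b ∧ u)) (m′ ∨ (b′ ∧ u′)) (sameStep u u′ b b′ j)
    ℕ.+ bit ((m ∧ b) xor (m′ ∧ b′))
  ℕ.≤ potential u u′ m m′ j ℕ.+ bit (b xor b′)
potential-step = decide (∀ᵇ? λ u → ∀ᵇ? λ u′ → ∀ᵇ? λ m → ∀ᵇ? λ m′ → ∀ᵇ? λ j → ∀ᵇ? λ b → ∀ᵇ? λ b′ →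
  T? _ →-dec (_ ℕ.≤? _))

-- The masks s and s′ stand for the complement of the final multi, which does not change while the
-- family is peeled off; the hypotheses say that it avoids the current multi.
private-step : ∀ u u′ m m′ j b b′ s s′ → T (valid u u′ m m′ j) →
  T (not s ∨ not (m ∨ (b ∧ u))) → T (not s′ ∨ not (m′ ∨ (b′ ∧ u′))) →
  bit ((b ∧ s) xor (b′ ∧ s′)) ℕ.+ 2 ℕ.* bit (sameStep u u′ b b′ j ∧ s ∧ s′)
    ℕ.+ (bit (u ∧ s) ℕ.+ bit (u′ ∧ s′))
  ℕ.≤ bit ((b ∨ u) ∧ s) ℕ.+ bit ((b′ ∨ u′) ∧ s′) ℕ.+ 2 ℕ.* bit (j ∧ s ∧ s′)
private-step = decide (∀ᵇ? λ u → ∀ᵇ? λ u′ → ∀ᵇ? λ m → ∀ᵇ? λ m′ → ∀ᵇ? λ j → ∀ᵇ? λ b → ∀ᵇ? λ b′ →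
  ∀ᵇ? λ s → ∀ᵇ? λ s′ → T? _ →-dec T? _ →-dec T? _ →-dec (_ ℕ.≤? _))

mask-weaken : ∀ s m x → T (not s ∨ not (m ∨ x)) → T (not s ∨ not m)
mask-weaken = decide (∀ᵇ? λ s → ∀ᵇ? λ m → ∀ᵇ? λ x → T? _ →-dec T? _)

mask-self : ∀ m → T (not (not m) ∨ not m)
mask-self = decide (∀ᵇ? λ m → T? _)

-- If just one endpoint is covered exactly once, the edge leaves the cover or enters the multiply
-- covered set. If both are, either `j` holds or the doubled term of the potential is present.
private-final : ∀ u u′ m m′ j → T (valid u u′ m m′ j) →
  bit (u ∧ not m) ℕ.+ bit (u′ ∧ not m′)
  ℕ.≤ potential u u′ m m′ j ℕ.+ 2 ℕ.* bit (j ∧ not m ∧ not m′)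
private-final = decide (∀ᵇ? λ u → ∀ᵇ? λ u′ → ∀ᵇ? λ m → ∀ᵇ? λ m′ → ∀ᵇ? λ j → T? _ →-dec (_ ℕ.≤? _))

bit≤1 : ∀ b → bit b ℕ.≤ 1
bit≤1 true  = ℕ.≤-refl
bit≤1 false = z≤n

bits≤2 : ∀ a b → bit a ℕ.+ bit b ℕ.≤ 2
bits≤2 = decide (∀ᵇ? λ a → ∀ᵇ? λ b → _ ℕ.≤? _)

-- Induction step of `private-sum`: the hypotheses are added and the terms `p` and `j` of the
-- smaller family cancel.
telescope : ∀ f σ j j′ p p′ → f ℕ.+ j′ ℕ.+ p ℕ.≤ p′ ℕ.+ j → σ ℕ.+ j ℕ.≤ p → f ℕ.+ σ ℕ.+ j′ ℕ.≤ p′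
telescope f σ j j′ p p′ h ih = ℕ.+-cancelʳ-≤ (p ℕ.+ j) _ _ (begin
  f ℕ.+ σ ℕ.+ j′ ℕ.+ (p ℕ.+ j)   ≡⟨ solve 5 (λ f σ j j′ p → f :+ σ :+ j′ :+ (p :+ j) := f :+ j′ :+ p :+ (σ :+ j))
                                         refl f σ j j′ p ⟩
  f ℕ.+ j′ ℕ.+ p ℕ.+ (σ ℕ.+ j)   ≤⟨ ℕ.+-mono-≤ h ih ⟩
  p′ ℕ.+ j ℕ.+ p                 ≡⟨ solve 3 (λ p′ j p → p′ :+ j :+ p := p′ :+ (p :+ j)) refl p′ j p ⟩
  p′ ℕ.+ (p ℕ.+ j)               ∎)
  where open ℕ.≤-Reasoning
        open ℕ.+-*-Solver

-- Families of sets, covering multiplicity and private parts.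

Family : ℕ → ℕ → Set
Family q n = Fin q → Subset n

-- A counts as covered at least twice already by the empty family.
cover : ∀ {n q} → Subset n → Family q n → Subset n
cover {q = zero}  A B = A
cover {q = suc q} A B = B zero ∪ cover A (tail B)

multi : ∀ {n q} → Subset n → Family q n → Subset n
multi {q = zero}  A B = A
multi {q = suc q} A B = multi A (tail B) ∪ (B zero ∩ cover A (tail B))

privatePart : ∀ {n q} → Subset n → Family q n → Family q n
privatePart A B i = B i ∩ ∁ (multi A B)

module _ {n : ℕ} where

  lookup-∪ : ∀ (X Y : Subset n) x → lookup (X ∪ Y) x ≡ lookup X x ∨ lookup Y x
  lookup-∪ X Y x = lookup-zipWith _∨_ x X Y

  lookup-∩ : ∀ (X Y : Subset n) x → lookup (X ∩ Y) x ≡ lookup X x ∧ lookup Y x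
  lookup-∩ X Y x = lookup-zipWith _∧_ x X Y

  lookup-∁ : ∀ (X : Subset n) x → lookup (∁ X) x ≡ not (lookup X x)
  lookup-∁ X x = lookup-map x not X

  multi-∪ : ∀ {q} (A : Subset n) (B : Family (suc q) n) x →
    lookup (multi A B) x ≡
    lookup (multi A (tail B)) x ∨ (lookup (B zero) x ∧ lookup (cover A (tail B)) x)
  multi-∪ A B x = trans (lookup-∪ (multi A (tail B)) _ x)
                        (cong (lookup (multi A (tail B)) x ∨_) (lookup-∩ (B zero) _ x))

  ∈cover⁻ : ∀ {q} (A : Subset n) (B : Family q n) {v} → v ∈ cover A B → v ∈ A ⊎ ∃ λ i → v ∈ B i
  ∈cover⁻ {zero}  A B v∈ = inj₁ v∈
  ∈cover⁻ {suc q} A B v∈ with x∈p∪q⁻ (B zero) _ v∈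
  ... | inj₁ v∈B₀ = inj₂ (zero , v∈B₀)
  ... | inj₂ v∈U with ∈cover⁻ A (tail B) v∈U
  ...   | inj₁ v∈A       = inj₁ v∈A
  ...   | inj₂ (i , v∈B) = inj₂ (suc i , v∈B)

  ⊆cover : ∀ {q} (A : Subset n) (B : Family q n) → A ⊆ cover A B
  ⊆cover {zero}  A B = id
  ⊆cover {suc q} A B = q⊆p∪q (B zero) _ ∘ ⊆cover A (tail B)

  member⊆cover : ∀ {q} (A : Subset n) (B : Family q n) i → B i ⊆ cover A B
  member⊆cover A B zero    = p⊆p∪q _
  member⊆cover A B (suc i) = q⊆p∪q (B zero) _ ∘ member⊆cover A (tail B) i

  ⊆multi : ∀ {q} (A : Subset n) (B : Family q n) → A ⊆ multi A B
  ⊆multi {zero}  A B = id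
  ⊆multi {suc q} A B = p⊆p∪q _ ∘ ⊆multi A (tail B)

  ∈multi⁻ : ∀ {q} (A : Subset n) (B : Family q n) {v} → v ∈ multi A B →
    v ∈ A ⊎ ∃ λ i → ∃ λ j → i ≢ j × v ∈ B i × v ∈ B j
  ∈multi⁻ {zero}  A B v∈ = inj₁ v∈
  ∈multi⁻ {suc q} A B v∈ with x∈p∪q⁻ (multi A (tail B)) _ v∈
  ... | inj₁ v∈M with ∈multi⁻ A (tail B) v∈M
  ...   | inj₁ v∈A = inj₁ v∈A
  ...   | inj₂ (i , j , i≢j , v∈Bᵢ , v∈Bⱼ) = inj₂ (suc i , suc j , (λ { refl → i≢j refl }) , v∈Bᵢ , v∈Bⱼ)
  ∈multi⁻ {suc q} A B v∈ | inj₂ v∈∩ with x∈p∩q⁻ (B zero) _ v∈∩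
  ...   | v∈B₀ , v∈U with ∈cover⁻ A (tail B) v∈U
  ...     | inj₁ v∈A = inj₁ v∈A
  ...     | inj₂ (j , v∈Bⱼ) = inj₂ (zero , suc j , (λ ()) , v∈B₀ , v∈Bⱼ)

  Private : ∀ {q} → Family q n → Fin q → Fin n → Set
  Private B i v = v ∈ B i × (∀ j → j ≢ i → v ∉ B j)

  private∈privatePart : ∀ {q} (A : Subset n) (B : Family q n) {i v} → v ∉ A → Private B i v →
    v ∈ privatePart A B i
  private∈privatePart A B {i} {v} v∉A (v∈Bᵢ , only) = x∈p∩q⁺ (v∈Bᵢ , x∉p⇒x∈∁p v∉multi)
    where
    v∉multi : v ∉ multi A B
    v∉multi v∈M with ∈multi⁻ A B v∈M
    ... | inj₁ v∈A = v∉A v∈A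
    ... | inj₂ (j , l , j≢l , v∈Bⱼ , v∈Bₗ) with j Fin.≟ i
    ...   | no  j≢i  = only j j≢i v∈Bⱼ
    ...   | yes refl = only l (j≢l ∘ sym) v∈Bₗ

  -- Supplies the bit `j` of the edge lemmas. Vertices of `A` never qualify, since they are covered
  -- from the start.
  same : ∀ {q} → Subset n → Family q n → Fin n → Fin n → Bool
  same {zero}  A B x y = false
  same {suc q} A B x y =
    sameStep (lookup (cover A (tail B)) x) (lookup (cover A (tail B)) y)
          (lookup (B zero) x) (lookup (B zero) y) (same A (tail B) x y)

  Valid : ∀ {q} → Subset n → Family q n → Fin n → Fin n → Bool
  Valid A B x y = valid (lookup (cover A B) x) (lookup (cover A B) y)
                        (lookup (multi A B) x) (lookup (multi A B) y) (same A B x y)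

  Potential : ∀ {q} → Subset n → Family q n → Fin n → Fin n → ℕ
  Potential A B x y = potential (lookup (cover A B) x) (lookup (cover A B) y)
                                (lookup (multi A B) x) (lookup (multi A B) y) (same A B x y)

  cuts : Subset n → Fin n → Fin n → Bool
  cuts X x y = lookup X x xor lookup X y

  Valid-holds : ∀ {q} (A : Subset n) (B : Family q n) x y → T (Valid A B x y)
  Valid-holds {zero}  A B x y = valid-start (lookup A x) (lookup A y)
  Valid-holds {suc q} A B x y
    rewrite lookup-∪ (B zero) (cover A (tail B)) x | lookup-∪ (B zero) (cover A (tail B)) y
          | multi-∪ A B x | multi-∪ A B y
    = valid-step (lookup (cover A (tail B)) x) _ (lookup (multi A (tail B)) x) _ (same A (tail B) x y)
                 (lookup (B zero) x) (lookup (B zero) y) (Valid-holds A (tail B) x y)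

  Potential-step : ∀ {q} (A : Subset n) (B : Family (suc q) n) x y →
    Potential A B x y ℕ.+ bit (cuts (multi A (tail B) ∩ B zero) x y)
    ℕ.≤ Potential A (tail B) x y ℕ.+ bit (cuts (B zero) x y)
  Potential-step A B x y
    rewrite lookup-∪ (B zero) (cover A (tail B)) x | lookup-∪ (B zero) (cover A (tail B)) y
          | multi-∪ A B x | multi-∪ A B y
          | lookup-∩ (multi A (tail B)) (B zero) x | lookup-∩ (multi A (tail B)) (B zero) y
    = potential-step (lookup (cover A (tail B)) x) _ (lookup (multi A (tail B)) x) _ (same A (tail B) x y)
                 (lookup (B zero) x) (lookup (B zero) y) (Valid-holds A (tail B) x y)

  -- A masked member is cut only at a masked endpoint inside it, and an edge with both ends in the
  -- same member is credited by the doubled `same` term. The masks are variables because `multi`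
  -- shrinks with the family during the induction.
  private-sum : ∀ {q} (A : Subset n) (B : Family q n) x y s s′ →
    T (not s ∨ not (lookup (multi A B) x)) → T (not s′ ∨ not (lookup (multi A B) y)) →
    sumℕ (λ i → bit ((lookup (B i) x ∧ s) xor (lookup (B i) y ∧ s′)))
      ℕ.+ 2 ℕ.* bit (same A B x y ∧ s ∧ s′)
    ℕ.≤ bit (lookup (cover A B) x ∧ s) ℕ.+ bit (lookup (cover A B) y ∧ s′)
  private-sum {zero}  A B x y s s′ _ _ = z≤n
  private-sum {suc q} A B x y s s′ hs hs′
    rewrite lookup-∪ (B zero) (cover A (tail B)) x | lookup-∪ (B zero) (cover A (tail B)) y
          | multi-∪ A B x | multi-∪ A B y
    = telescope (bit ((lookup (B zero) x ∧ s) xor (lookup (B zero) y ∧ s′))) _ _ _ _ _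
        (private-step (lookup (cover A (tail B)) x) _ (lookup (multi A (tail B)) x) _ (same A (tail B) x y)
                 (lookup (B zero) x) (lookup (B zero) y) s s′ (Valid-holds A (tail B) x y) hs hs′)
        (private-sum A (tail B) x y s s′ (mask-weaken s _ _ hs) (mask-weaken s′ _ _ hs′))

  private-sum≤once : ∀ {q} (A : Subset n) (B : Family q n) x y →
    sumℕ (λ i → bit (cuts (privatePart A B i) x y))
      ℕ.+ 2 ℕ.* bit (same A B x y ∧ not (lookup (multi A B) x) ∧ not (lookup (multi A B) y))
    ℕ.≤ bit (lookup (cover A B) x ∧ not (lookup (multi A B) x))
      ℕ.+ bit (lookup (cover A B) y ∧ not (lookup (multi A B) y))
  private-sum≤once A B x y = ℕ.≤-trans
      (ℕ.+-monoˡ-≤ (2 ℕ.* bit (same A B x y ∧ not (lookup (multi A B) x) ∧ not (lookup (multi A B) y)))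
        (ℕ.≤-reflexive (sumℕ-cong-≗ (λ i → cong bit (cong₂ _xor_ (eq i x) (eq i y))))))
      (private-sum A B x y _ _ (mask-self (lookup (multi A B) x)) (mask-self (lookup (multi A B) y)))
    where
    eq : ∀ i z → lookup (privatePart A B i) z ≡ lookup (B i) z ∧ not (lookup (multi A B) z)
    eq i z = trans (lookup-∩ (B i) _ z) (cong (lookup (B i) z ∧_) (lookup-∁ (multi A B) z))

  -- Edgewise form of the bound on the total cut of the private parts; the doubled `same` terms on
  -- the two sides cancel.
  private-sum≤Potential : ∀ {q} (A : Subset n) (B : Family q n) x y →
    sumℕ (λ i → bit (cuts (privatePart A B i) x y)) ℕ.≤ Potential A B x y
  private-sum≤Potential A B x y = ℕ.+-cancelʳ-≤ _ _ _ (ℕ.≤-trans (private-sum≤once A B x y)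
    (private-final (lookup (cover A B) x) _ (lookup (multi A B) x) _ (same A B x y) (Valid-holds A B x y)))

  -- Each endpoint lies in at most one private part. This serves the first-stage edges, which have
  -- weight zero in the cut function being uncrossed.
  private-sum≤2 : ∀ {q} (A : Subset n) (B : Family q n) x y →
    sumℕ (λ i → bit (cuts (privatePart A B i) x y)) ℕ.≤ 2
  private-sum≤2 A B x y = ℕ.≤-trans (ℕ.m≤m+n _ _) (ℕ.≤-trans (private-sum≤once A B x y)
    (bits≤2 (lookup (cover A B) x ∧ _) (lookup (cover A B) y ∧ _)))

  -- Discard a member while the others still cover `Y`. Once none can be discarded, each member has
  -- a point of `Y` missed by all others; as that point is covered, it lies in the member itself.
  irredundant : (Y : Subset n) (Good : Subset n → Set) → ∀ q (B : Family q n) →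
    (∀ i → Good (B i)) → (∀ v → v ∈ Y → ∃ λ i → v ∈ B i) →
    ∃ λ q′ → Σ (Family q′ n) λ B′ → (∀ i → Good (B′ i)) ×
      (∀ v → v ∈ Y → ∃ λ i → v ∈ B′ i) × (∀ i → ∃ λ v → v ∈ Y × Private B′ i v)
  irredundant Y Good zero    B good covers = zero , B , good , covers , λ ()
  irredundant Y Good (suc q) B good covers
    with any? (λ i → all? (λ v → (v ∈? Y) →-dec any? (λ j → v ∈? B (punchIn i j))))
  ... | yes (i , covers′) = irredundant Y Good q (B ∘ punchIn i) (good ∘ punchIn i) covers′
  ... | no  none = suc q , B , good , covers , priv
    where
    priv : ∀ i → ∃ λ v → v ∈ Y × Private B i v
    priv i with ¬∀⟶∃¬ n _ (λ v → (v ∈? Y) →-dec any? (λ j → v ∈? B (punchIn i j))) (λ h → none (i , h))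
    ... | v , ¬covered = v , v∈Y , v∈Bᵢ , only
      where
      v∈Y : v ∈ Y
      v∈Y = decidable-stable (v ∈? Y) (λ v∉Y → ¬covered (λ v∈Y → contradiction v∈Y v∉Y))
      only : ∀ j → j ≢ i → v ∉ B j
      only j j≢i v∈Bⱼ = ¬covered (λ _ → punchOut (j≢i ∘ sym) ,
        subst (λ l → v ∈ B l) (sym (punchIn-punchOut (j≢i ∘ sym))) v∈Bⱼ)
      v∈Bᵢ : v ∈ B i
      v∈Bᵢ with covers v v∈Y
      ... | j , v∈Bⱼ with j Fin.≟ i
      ...   | yes refl = v∈Bⱼ
      ...   | no  j≢i  = contradiction v∈Bⱼ (only j j≢i)

-- Rational arithmetic and weighted edge counts.

+-cancelʳ-≤ : ∀ z {x y} → x + z ≤ y + z → x ≤ y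
+-cancelʳ-≤ z {x} {y} h = subst₂ _≤_ (undo x) (undo y) (ℚ.+-monoˡ-≤ (- z) h)
  where
  undo : ∀ x → x + z + - z ≡ x
  undo x = trans (ℚ.+-assoc x z (- z)) (trans (cong (_+_ x) (ℚ.+-inverseʳ z)) (ℚ.+-identityʳ x))

p≤q+p : ∀ {p q} → 0ℚ ≤ q → p ≤ q + p
p≤q+p {p} 0≤q = ℚ.≤-trans (ℚ.≤-reflexive (sym (ℚ.+-identityˡ p))) (ℚ.+-monoˡ-≤ p 0≤q)

·-nonNeg : ∀ a {x} → 0ℚ ≤ x → 0ℚ ≤ a · x
·-nonNeg zero    0≤x = ℚ.≤-refl
·-nonNeg (suc a) 0≤x = ℚ.≤-trans (·-nonNeg a 0≤x) (p≤q+p 0≤x)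

·-monoˡ-≤ : ∀ {a b x} → 0ℚ ≤ x → a ℕ.≤ b → a · x ≤ b · x
·-monoˡ-≤ {b = b} 0≤x z≤n = ·-nonNeg b 0≤x
·-monoˡ-≤ {x = x} 0≤x (s≤s a≤b) = ℚ.+-monoʳ-≤ x (·-monoˡ-≤ 0≤x a≤b)

·-monoʳ-≤ : ∀ a {x y} → x ≤ y → a · x ≤ a · y
·-monoʳ-≤ zero    x≤y = ℚ.≤-refl
·-monoʳ-≤ (suc a) x≤y = ℚ.+-mono-≤ x≤y (·-monoʳ-≤ a x≤y)

·-* : ∀ a x y → a · (x * y) ≡ x * (a · y)
·-* zero    x y = sym (ℚ.*-zeroʳ x)
·-* (suc a) x y = trans (cong (_+_ (x * y)) (·-* a x y)) (sym (ℚ.*-distribˡ-+ x y (a · y)))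

sum-mono-≤ : ∀ {m} {f g : Fin m → ℚ} → (∀ e → f e ≤ g e) → sum f ≤ sum g
sum-mono-≤ {zero}  f≤g = ℚ.≤-refl
sum-mono-≤ {suc m} f≤g = ℚ.+-mono-≤ (f≤g zero) (sum-mono-≤ (f≤g ∘ suc))

-- Multiplicities are natural numbers, so that the inequalities decided on bits transfer edge by
-- edge to any nonnegative weights.
weight : ∀ {m} → (Fin m → ℚ) → (Fin m → ℕ) → ℚ
weight w f = sum (λ e → f e · w e)

module _ {m} {w : Fin m → ℚ} where

  weight-+ : ∀ f g → weight w (λ e → f e ℕ.+ g e) ≡ weight w f + weight w g
  weight-+ f g = trans (sum-cong-≗ (λ e → ×-homo-+ (w e) (f e) (g e))) (∑-distrib-+ (λ e → f e · w e) _)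

  weight-mono-≤ : ∀ {f g} → (∀ e → 0ℚ ≤ w e) → (∀ e → f e ℕ.≤ g e) → weight w f ≤ weight w g
  weight-mono-≤ 0≤w f≤g = sum-mono-≤ (λ e → ·-monoˡ-≤ (0≤w e) (f≤g e))

  weight-+-mono-≤ : ∀ {f g f′ g′} → (∀ e → 0ℚ ≤ w e) → (∀ e → f e ℕ.+ g e ℕ.≤ f′ e ℕ.+ g′ e) →
    weight w f + weight w g ≤ weight w f′ + weight w g′
  weight-+-mono-≤ {f} {g} {f′} {g′} 0≤w h =
    subst₂ _≤_ (weight-+ f g) (weight-+ f′ g′) (weight-mono-≤ 0≤w h)

  ·≤weight-sum : ∀ {q τ} (f : Fin q → Fin m → ℕ) → (∀ i → τ ≤ weight w (f i)) →
    q · τ ≤ weight w (λ e → sumℕ (λ i → f i e))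
  ·≤weight-sum {zero} f τ≤ = ℚ.≤-reflexive (sym (sum-replicate-zero m))
  ·≤weight-sum {suc q} f τ≤ = ℚ.≤-trans (ℚ.+-mono-≤ (τ≤ zero) (·≤weight-sum (tail f) (τ≤ ∘ suc)))
    (ℚ.≤-reflexive (sym (weight-+ (f zero) _)))

weight-nonNeg : ∀ {m} {w : Fin m → ℚ} → (∀ e → 0ℚ ≤ w e) → ∀ f → 0ℚ ≤ weight w f
weight-nonNeg {m} {w} 0≤w f = ℚ.≤-trans (ℚ.≤-reflexive (sym (sum-replicate-zero m)))
  (sum-mono-≤ (λ e → ·-nonNeg (f e) (0≤w e)))

cost≡weight : ∀ {m} (c : Fin m → ℚ) F → cost c F ≡ weight c (bit ∘ lookup F)
cost≡weight {zero}  c []          = refl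
cost≡weight {suc m} c (true ∷ F)  = cong₂ _+_ (sym (ℚ.+-identityʳ (c zero))) (cost≡weight (c ∘ suc) F)
cost≡weight {suc m} c (false ∷ F) = trans (cost≡weight (c ∘ suc) F) (sym (ℚ.+-identityˡ _))

-- Finite subsets, exhaustive search and the second-stage maximum.

∣p∪q∣≤∣p∣+∣q∣ : ∀ {n} (p q : Subset n) → ∣ p ∪ q ∣ ℕ.≤ ∣ p ∣ ℕ.+ ∣ q ∣
∣p∪q∣≤∣p∣+∣q∣ []            []            = z≤n
∣p∪q∣≤∣p∣+∣q∣ (inside  ∷ p) (inside  ∷ q) =
  s≤s (ℕ.≤-trans (∣p∪q∣≤∣p∣+∣q∣ p q) (ℕ.+-monoʳ-≤ ∣ p ∣ (ℕ.n≤1+n _)))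
∣p∪q∣≤∣p∣+∣q∣ (inside  ∷ p) (outside ∷ q) = s≤s (∣p∪q∣≤∣p∣+∣q∣ p q)
∣p∪q∣≤∣p∣+∣q∣ (outside ∷ p) (inside  ∷ q) =
  ℕ.≤-trans (s≤s (∣p∪q∣≤∣p∣+∣q∣ p q)) (ℕ.≤-reflexive (sym (ℕ.+-suc ∣ p ∣ ∣ q ∣)))
∣p∪q∣≤∣p∣+∣q∣ (outside ∷ p) (outside ∷ q) = ∣p∪q∣≤∣p∣+∣q∣ p q

-- Pads a small set of terminals to a scenario, which must have exactly `k` elements.
intermediateSubset : ∀ {n} (W U : Subset n) k → W ⊆ U → ∣ W ∣ ℕ.≤ k → k ℕ.≤ ∣ U ∣ →
  ∃ λ D → W ⊆ D × D ⊆ U × ∣ D ∣ ≡ k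
intermediateSubset []            []            zero    W⊆U _ _ = [] , id , id , refl
intermediateSubset (inside  ∷ W) (outside ∷ U) k       W⊆U _ _ with () ← W⊆U Vec.here
intermediateSubset (inside  ∷ W) (inside  ∷ U) (suc k) W⊆U (s≤s W≤k) (s≤s k≤U)
  with D , W⊆D , D⊆U , ∣D∣≡k ← intermediateSubset W U k (drop-∷-⊆ W⊆U) W≤k k≤U =
  inside ∷ D , in⊆in W⊆D , in⊆in D⊆U , cong suc ∣D∣≡k
intermediateSubset (outside ∷ W) (outside ∷ U) k       W⊆U W≤k k≤U
  with D , W⊆D , D⊆U , ∣D∣≡k ← intermediateSubset W U k (drop-∷-⊆ W⊆U) W≤k k≤U =
  outside ∷ D , out⊆ W⊆D , out⊆ D⊆U , ∣D∣≡k
intermediateSubset (outside ∷ W) (inside  ∷ U) k       W⊆U W≤k k≤1+U with ℕ.m≤n⇒m<n∨m≡n k≤1+U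
-- Here `k` equals the size of the whole set, so everything is taken; otherwise the head can be left
-- out.
... | inj₂ refl      = inside ∷ U , out⊆ (drop-∷-⊆ W⊆U) , id , refl
... | inj₁ (s≤s k≤U)
  with D , W⊆D , D⊆U , ∣D∣≡k ← intermediateSubset W U k (drop-∷-⊆ W⊆U) W≤k k≤U =
  outside ∷ D , out⊆ W⊆D , out⊆ D⊆U , ∣D∣≡k

∈-allSubsets : ∀ {n} (X : Subset n) → X ∈ˡ allSubsets n
∈-allSubsets []          = Any.here refl
∈-allSubsets (true  ∷ X) = ∈-++⁺ˡ (∈-map⁺ (true ∷_) (∈-allSubsets X))
∈-allSubsets (false ∷ X) = ∈-++⁺ʳ (List.map (true ∷_) (allSubsets _)) (∈-map⁺ (false ∷_) (∈-allSubsets X))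

argminSubset : ∀ {n} {P : Subset n → Set} → Decidable P → (f : Subset n → ℚ) → ∃ P →
  ∃ λ A → P A × (∀ Z → P Z → f A ≤ f Z)
argminSubset {n} P? f (X , PX) =
  -- The given `X` is the default value of `argmin`; it satisfies `P`, so the result does in every
  -- case.
  argmin f X candidates , argmin-all f PX (all-filter P? (allSubsets n)) ,
  λ Z PZ → All.lookup (f[argmin]≤f[xs] X candidates) (∈-filter⁺ P? (∈-allSubsets Z) PZ)
  where candidates = filter P? (allSubsets n)

-- Double negation passes through a finite conjunction, so excluded middle may be assumed at all
-- vertices at once when proving a negation.
¬¬-all : ∀ {n} {P : Fin n → Set} → (∀ i → ¬ ¬ P i) → ¬ ¬ (∀ i → P i)
¬¬-all {zero}  h k = k λ ()
¬¬-all {suc n} h k = h zero λ p₀ → ¬¬-all (h ∘ suc) λ ps → k λ { zero → p₀ ; (suc i) → ps i }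

secondStage-nonNeg : ∀ {n m} (c : Fin m → ℚ) (U : Subset n) k E → 0ℚ ≤ secondStage c U k E
secondStage-nonNeg {n} c U k E = go (allSubsets n)
  where
  go : ∀ xs → 0ℚ ≤ List.foldr (λ D acc → (if isScenario U k D then cost c (E D) else 0ℚ) ⊔ acc) 0ℚ xs
  go List.[]       = ℚ.≤-refl
  go (D List.∷ xs) = ℚ.≤-trans (go xs) (ℚ.p≤q⊔p (if isScenario U k D then cost c (E D) else 0ℚ) _)

cost≤secondStage : ∀ {n m} (c : Fin m → ℚ) (U : Subset n) k E D → D ⊆ U → ∣ D ∣ ≡ k →
  cost c (E D) ≤ secondStage c U k E
cost≤secondStage {n} c U k E D D⊆U ∣D∣≡k = go (∈-allSubsets D)
  where
  scenario : isScenario U k D ≡ true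
  scenario with D ⊆? U | ∣ D ∣ ℕ.≟ k
  ... | yes _ | yes _ = refl
  ... | no D⊈U | _ = contradiction (λ {x} → D⊆U {x}) D⊈U
  ... | yes _ | no ∣D∣≢k = contradiction ∣D∣≡k ∣D∣≢k
  go : ∀ {xs} → D ∈ˡ xs → cost c (E D) ≤
    List.foldr (λ D acc → (if isScenario U k D then cost c (E D) else 0ℚ) ⊔ acc) 0ℚ xs
  go (Any.here refl) rewrite scenario = ℚ.p≤p⊔q (cost c (E D)) _
  go {D′ List.∷ _} (Any.there D∈) =
    ℚ.≤-trans (go D∈) (ℚ.p≤q⊔p (if isScenario U k D′ then cost c (E D′) else 0ℚ) _)

-- Edge boundaries, separators and minimum cuts.

submodular-bits : ∀ a a′ b b′ →
  bit ((a ∨ b) xor (a′ ∨ b′)) ℕ.+ bit ((a ∧ b) xor (a′ ∧ b′)) ℕ.≤ bit (a xor a′) ℕ.+ bit (b xor b′)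
submodular-bits = decide (∀ᵇ? λ a → ∀ᵇ? λ a′ → ∀ᵇ? λ b → ∀ᵇ? λ b′ → _ ℕ.≤? _)

module Boundary {n m} (G : Graph n m) where

  boundary : Subset n → Subset m
  boundary X = tabulate (λ e → cuts X (end₁ G e) (end₂ G e))

  crossings : Subset n → Fin m → ℕ
  crossings X e = bit (cuts X (end₁ G e) (end₂ G e))

  cutWeight : (Fin m → ℚ) → Subset n → ℚ
  cutWeight w X = weight w (crossings X)

  cost-boundary : ∀ c X → cost c (boundary X) ≡ cutWeight c X
  cost-boundary c X = trans (cost≡weight c (boundary X))
    (sum-cong-≗ (λ e → cong (λ b → bit b · c e) (lookup∘tabulate (λ e → cuts X (end₁ G e) (end₂ G e)) e)))

  ∉boundary : ∀ X e → e ∉ boundary X → lookup X (end₁ G e) ≡ lookup X (end₂ G e)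
  ∉boundary X e e∉ = agree _ _ (λ eq → e∉ (lookup⇒[]= e _
    (trans (lookup∘tabulate (λ e → cuts X (end₁ G e) (end₂ G e)) e) eq)))
    where
    agree : ∀ a b → ¬ (a xor b ≡ true) → a ≡ b
    agree true  true  _ = refl
    agree true  false h = contradiction refl h
    agree false true  h = contradiction refl h
    agree false false _ = refl

  -- Both ends of an edge outside the boundary lie on the same side, so membership in `X` would
  -- propagate back along the walk to `r`.
  unreachable : ∀ {r v} X → r ∉ X → Conn G (boundary X) r v → v ∉ X
  unreachable X r∉X here = r∉X
  unreachable {r} {v} X r∉X (step {w} e e∉ joins conn) v∈X =
    unreachable X r∉X conn (lookup⇒[]= w X (trans (agree joins) ([]=⇒lookup v∈X)))
    where
    agree : (end₁ G e ≡ w × end₂ G e ≡ v) ⊎ (end₂ G e ≡ w × end₁ G e ≡ v) → lookup X w ≡ lookup X v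
    agree (inj₁ (refl , refl)) = ∉boundary X e e∉
    agree (inj₂ (refl , refl)) = sym (∉boundary X e e∉)

  boundary-separates : ∀ {r} X Y → r ∉ X → Y ⊆ X → Separates G r (boundary X) Y
  boundary-separates X Y r∉X Y⊆X v v∈Y conn = unreachable X r∉X conn (Y⊆X v∈Y)

  -- Only ¬¬: reachability is not decided here, and cut weights are compared by a decidable relation.
  separator⇒cut : ∀ {r F} Y → Separates G r F Y →
    ¬ ¬ ∃ λ X → Y ⊆ X × r ∉ X × (∀ e → lookup F e ≡ false → cuts X (end₁ G e) (end₂ G e) ≡ false)
  separator⇒cut {r} {F} Y sep k = ¬¬-all (λ v → ¬¬-excluded-middle) λ (conn? : ∀ v → Dec (Conn G F r v)) →
    -- `X` is the unreachable side. An edge outside `F` cannot cross it, since in either direction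
    -- it would extend a walk from `r`.
    let X = tabulate (λ v → not (does (conn? v)))
        look : ∀ v → lookup X v ≡ not (does (conn? v))
        look v = lookup∘tabulate (λ v → not (does (conn? v))) v
        ∈X : ∀ v → ¬ Conn G F r v → v ∈ X
        ∈X v ¬c = lookup⇒[]= v X (trans (look v) (cong not (dec-false (conn? v) ¬c)))
        ∉X : ∀ v → Conn G F r v → v ∉ X
        ∉X v c v∈X = contradiction (trans (sym ([]=⇒lookup v∈X))
          (trans (look v) (cong not (dec-true (conn? v) c)))) λ ()
        closed : ∀ {v w e} → lookup F e ≡ false →
          (end₁ G e ≡ v × end₂ G e ≡ w) ⊎ (end₂ G e ≡ v × end₁ G e ≡ w) → Conn G F r v → Conn G F r w
        closed e∉F joins = step _ (λ e∈F → contradiction (trans (sym ([]=⇒lookup e∈F)) e∉F) λ ()) joins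
        uncut : ∀ e → lookup F e ≡ false → cuts X (end₁ G e) (end₂ G e) ≡ false
        uncut e e∉F = trans (cong₂ _xor_ (look (end₁ G e)) (look (end₂ G e)))
          (trans (cong (λ b → not b xor not (does (conn? (end₂ G e))))
             (does-⇔ (mk⇔ (closed e∉F (inj₁ (refl , refl))) (closed e∉F (inj₂ (refl , refl)))) (conn? _) (conn? _)))
           (xor-same (not (does (conn? (end₂ G e))))))
    in k (X , (λ {v} v∈Y → ∈X v (sep v v∈Y)) , ∉X r here , uncut)

  module Cuts (r : Fin n) (w : Fin m → ℚ) (0≤w : ∀ e → 0ℚ ≤ w e) where

    δ : Subset n → ℚ
    δ = cutWeight w

    submodular : ∀ X Y → δ (X ∪ Y) + δ (X ∩ Y) ≤ δ X + δ Y
    submodular X Y = weight-+-mono-≤ {f = crossings (X ∪ Y)} {g′ = crossings Y} 0≤w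
      λ e → edge (end₁ G e) (end₂ G e)
      where
      edge : ∀ x y → bit (cuts (X ∪ Y) x y) ℕ.+ bit (cuts (X ∩ Y) x y) ℕ.≤ bit (cuts X x y) ℕ.+ bit (cuts Y x y)
      edge x y rewrite lookup-∪ X Y x | lookup-∪ X Y y | lookup-∩ X Y x | lookup-∩ X Y y =
        submodular-bits (lookup X x) (lookup X y) (lookup Y x) (lookup Y y)

    IsMinCut : Subset n → Subset n → Set
    IsMinCut D A = D ⊆ A × r ∉ A × (∀ Z → D ⊆ Z → r ∉ Z → δ A ≤ δ Z)

    minCut : ∀ D → r ∉ D → ∃ (IsMinCut D)
    minCut D r∉D =
      let A , (D⊆A , r∉A) , min = argminSubset {P = λ Z → D ⊆ Z × r ∉ Z}
                                    (λ Z → D ⊆? Z ×-dec ¬? (r ∈? Z)) δ (D , id , r∉D)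
      in A , D⊆A , r∉A , λ Z D⊆Z r∉Z → min Z (D⊆Z , r∉Z)

    Enlarges : ℚ → Subset n → Subset n → Set
    Enlarges ε A B = A ⊆ B × r ∉ B × δ B ≤ δ A + ε

    enlarges? : ∀ ε A → Decidable (Enlarges ε A)
    enlarges? ε A B = A ⊆? B ×-dec ¬? (r ∈? B) ×-dec δ B ℚ.≤? δ A + ε

    -- Uncrossing a family of near-minimum cuts.

    module Uncross {ε : ℚ} {A : Subset n} (minA : IsMinCut A A) where

      potentialWeight : ∀ {q} → Family q n → ℚ
      potentialWeight B = weight w (λ e → Potential A B (end₁ G e) (end₂ G e))

      r∉cover : ∀ {q} (B : Family q n) → (∀ i → r ∉ B i) → r ∉ cover A B
      r∉cover B r∉B r∈ with ∈cover⁻ A B r∈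
      ... | inj₁ r∈A = proj₁ (proj₂ minA) r∈A
      ... | inj₂ (i , r∈Bᵢ) = r∉B i r∈Bᵢ

      r∉multi : ∀ {q} (B : Family q n) → (∀ i → r ∉ B i) → r ∉ multi A B
      r∉multi B r∉B r∈ with ∈multi⁻ A B r∈
      ... | inj₁ r∈A = proj₁ (proj₂ minA) r∈A
      ... | inj₂ (i , _ , _ , r∈Bᵢ , _) = r∉B i r∈Bᵢ

      -- The empty family has potential at most `δ A + δ A`. Adding a member raises it by at most
      -- `δ (B zero)` minus the cut of `M ∩ B zero`; that set contains `A` and avoids `r`, so it
      -- costs at least `δ A` and the net increase is at most `ε`.
      potentialWeight-≤ : ∀ {q} (B : Family q n) → (∀ i → Enlarges ε A (B i)) →
        potentialWeight B ≤ δ A + δ A + q · ε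
      potentialWeight-≤ {zero} B enl = ℚ.≤-trans
        (weight-mono-≤ 0≤w (λ e → potential-start (lookup A (end₁ G e)) (lookup A (end₂ G e))))
        (ℚ.≤-reflexive (trans (weight-+ (crossings A) (crossings A)) (sym (ℚ.+-identityʳ _))))
      potentialWeight-≤ {suc q} B enl = +-cancelʳ-≤ (δ A) (begin
        potentialWeight B + δ A                ≤⟨ ℚ.+-monoʳ-≤ (potentialWeight B)
                                                    (proj₂ (proj₂ minA) (M ∩ B zero) A⊆M∩B r∉M∩B) ⟩
        potentialWeight B + δ (M ∩ B zero)     ≤⟨ weight-+-mono-≤ {f = λ e → Potential A B (end₁ G e) (end₂ G e)}
                                                    {g′ = crossings (B zero)} 0≤w (λ e → Potential-step A B (end₁ G e) (end₂ G e)) ⟩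
        potentialWeight (tail B) + δ (B zero)  ≤⟨ ℚ.+-mono-≤ (potentialWeight-≤ (tail B) (enl ∘ suc))
                                                    (proj₂ (proj₂ (enl zero))) ⟩
        δ A + δ A + q · ε + (δ A + ε)          ≡⟨ solve 3 (λ a x e → a :+ a :+ x :+ (a :+ e) := a :+ a :+ (e :+ x) :+ a)
                                                    refl (δ A) (q · ε) ε ⟩
        δ A + δ A + (ε + q · ε) + δ A          ∎)
        where
        open ℚ.≤-Reasoning
        open ℚ.+-*-Solver
        M = multi A (tail B)
        A⊆M∩B : A ⊆ M ∩ B zero
        A⊆M∩B v∈A = x∈p∩q⁺ (⊆multi A (tail B) v∈A , proj₁ (enl zero) v∈A)
        r∉M∩B : r ∉ M ∩ B zero
        r∉M∩B r∈ = proj₁ (proj₂ (enl zero)) (proj₂ (x∈p∩q⁻ M _ r∈))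

      -- The potential dominates the cuts of `cover` and `multi` together, and `multi` accounts for
      -- at least `δ A` by minimality.
      cover-≤ : ∀ {q} (B : Family q n) → (∀ i → Enlarges ε A (B i)) → δ (cover A B) ≤ δ A + q · ε
      cover-≤ {q} B enl = +-cancelʳ-≤ (δ A) (begin
        δ (cover A B) + δ A            ≤⟨ ℚ.+-monoʳ-≤ (δ (cover A B)) (proj₂ (proj₂ minA) (multi A B)
                                            (⊆multi A B) (r∉multi B (proj₁ ∘ proj₂ ∘ enl))) ⟩
        δ (cover A B) + δ (multi A B)  ≡⟨ weight-+ (crossings (cover A B)) (crossings (multi A B)) ⟨
        weight w (λ e → crossings (cover A B) e ℕ.+ crossings (multi A B) e)
                                       ≤⟨ weight-mono-≤
                                            {f = λ e → crossings (cover A B) e ℕ.+ crossings (multi A B) e}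
                                            {g = λ e → Potential A B (end₁ G e) (end₂ G e)}
                                            0≤w (λ e → ℕ.m≤m+n _ _) ⟩
        potentialWeight B              ≤⟨ potentialWeight-≤ B enl ⟩
        δ A + δ A + q · ε              ≡⟨ solve 2 (λ a x → a :+ a :+ x := a :+ x :+ a) refl (δ A) (q · ε) ⟩
        δ A + q · ε + δ A              ∎)
        where
        open ℚ.≤-Reasoning
        open ℚ.+-*-Solver

    -- The intersection `A ∩ A′` still contains `D`, so it costs at least `δ A`; submodularity
    -- leaves at most `δ A′` for the union.
    ∪-enlarges : ∀ {ε D A A′} → IsMinCut D A → D ⊆ A′ → r ∉ A′ → δ A′ ≤ δ A + ε → Enlarges ε A (A ∪ A′)
    ∪-enlarges {ε} {D} {A} {A′} (D⊆A , r∉A , min) D⊆A′ r∉A′ A′≤ =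
      p⊆p∪q A′ , (λ r∈ → [ r∉A , r∉A′ ]′ (x∈p∪q⁻ A A′ r∈)) ,
      +-cancelʳ-≤ (δ A) (begin
        δ (A ∪ A′) + δ A         ≤⟨ ℚ.+-monoʳ-≤ (δ (A ∪ A′)) (min (A ∩ A′)
                                      (λ v∈D → x∈p∩q⁺ (D⊆A v∈D , D⊆A′ v∈D)) (r∉A ∘ proj₁ ∘ x∈p∩q⁻ A A′)) ⟩
        δ (A ∪ A′) + δ (A ∩ A′)  ≤⟨ submodular A A′ ⟩
        δ A + δ A′               ≡⟨ ℚ.+-comm (δ A) (δ A′) ⟩
        δ A′ + δ A               ≤⟨ ℚ.+-monoˡ-≤ (δ A) A′≤ ⟩
        δ A + ε + δ A            ∎)
      where open ℚ.≤-Reasoning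

    -- Greedy choice of terminals and the covering family.

    module Greedy (S : Subset n) (k : ℕ) (t ε : ℚ) (0≤ε : 0ℚ ≤ ε) (k·ε≡t : k · ε ≡ t)
      (cheap : ∀ D → D ⊆ S → ∣ D ∣ ℕ.≤ k → ¬ ¬ ∃ λ X → D ⊆ X × r ∉ X × δ X ≤ t) where

      Saturated : Subset n → Set
      Saturated A = IsMinCut A A × δ A ≤ t × (∀ v → v ∈ S → ∃ λ B → v ∈ B × Enlarges ε A B)

      r∉small : ∀ {D} → D ⊆ S → ∣ D ∣ ℕ.≤ k → r ∉ D
      r∉small {D} D⊆S ∣D∣≤k r∈D = cheap D D⊆S ∣D∣≤k λ (X , D⊆X , r∉X , _) → r∉X (D⊆X r∈D)

      -- The cheap cut exists only under double negation, which suffices because comparison of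
      -- rationals is decidable.
      minCut≤t : ∀ {D A} → D ⊆ S → ∣ D ∣ ℕ.≤ k → IsMinCut D A → δ A ≤ t
      minCut≤t {D} {A} D⊆S ∣D∣≤k (_ , _ , min) = decidable-stable (δ A ℚ.≤? t) λ ≰t →
        cheap D D⊆S ∣D∣≤k λ (X , D⊆X , r∉X , X≤t) → ≰t (ℚ.≤-trans (min X D⊆X r∉X) X≤t)

      -- i terminals chosen so far, f + 1 choices left; a k-th jump would push the minimum cut above k · ε ≡ t.
      greedy : ∀ f i {D A} → i ℕ.+ suc f ≡ k → D ⊆ S → ∣ D ∣ ℕ.≤ i → IsMinCut D A → i · ε ≤ δ A → ∃ Saturated
      greedy f i {D} {A} i+f≡k D⊆S ∣D∣≤i minA@(D⊆A , r∉A , min) iε≤A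
        with any? (λ v → (v ∈? S) ×-dec ¬? (anySubset? (λ B → v ∈? B ×-dec enlarges? ε A B)))
      -- Every superset of `A` contains `D`, so the minimum cut of `D` is also a minimum cut of
      -- itself.
      ... | no none = A , (id , r∉A , λ Z A⊆Z → min Z (A⊆Z ∘ D⊆A)) ,
            minCut≤t D⊆S (ℕ.≤-trans ∣D∣≤i (ℕ.m+n≤o⇒m≤o i (ℕ.≤-reflexive i+f≡k))) minA ,
            λ v v∈S → decidable-stable (anySubset? (λ B → v ∈? B ×-dec enlarges? ε A B))
                        (λ ¬B → none (v , v∈S , ¬B))
      ... | yes (v , v∈S , far) = continue f i+f≡k
        where
        D′ = D ∪ ⁅ v ⁆
        D′⊆S : D′ ⊆ S
        D′⊆S x∈ with x∈p∪q⁻ D ⁅ v ⁆ x∈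
        ... | inj₁ x∈D = D⊆S x∈D
        ... | inj₂ x∈v with refl ← x∈⁅y⁆⇒x≡y v x∈v = v∈S
        ∣D′∣≤1+i : ∣ D′ ∣ ℕ.≤ suc i
        ∣D′∣≤1+i = ℕ.≤-trans (∣p∪q∣≤∣p∣+∣q∣ D ⁅ v ⁆)
          (ℕ.≤-trans (ℕ.+-mono-≤ ∣D∣≤i (ℕ.≤-reflexive (∣⁅x⁆∣≡1 v))) (ℕ.≤-reflexive (ℕ.+-comm i 1)))
        1+i≤k : suc i ℕ.≤ k
        1+i≤k = subst (suc i ℕ.≤_) i+f≡k (ℕ.≤-trans (ℕ.m≤m+n (suc i) f) (ℕ.≤-reflexive (sym (ℕ.+-suc i f))))
        ∣D′∣≤k = ℕ.≤-trans ∣D′∣≤1+i 1+i≤k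
        A′-min : ∃ (IsMinCut D′)
        A′-min = minCut D′ (r∉small D′⊆S ∣D′∣≤k)
        A′ = proj₁ A′-min
        minA′ = proj₂ A′-min
        jump : δ A + ε < δ A′
        -- Otherwise `A ∪ A′` would be an enlargement of `A` containing `v`, contrary to `far`.
        jump = ℚ.≰⇒> λ A′≤ → far (A ∪ A′ , q⊆p∪q A A′ (proj₁ minA′ (q⊆p∪q D ⁅ v ⁆ (x∈⁅x⁆ v))) ,
          ∪-enlarges minA (proj₁ minA′ ∘ p⊆p∪q ⁅ v ⁆) (proj₁ (proj₂ minA′)) A′≤)
        1+iε<A′ : suc i · ε < δ A′
        1+iε<A′ = ℚ.≤-<-trans (ℚ.≤-trans (ℚ.+-monoʳ-≤ ε iε≤A) (ℚ.≤-reflexive (ℚ.+-comm ε (δ A)))) jump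
        continue : ∀ f → i ℕ.+ suc f ≡ k → ∃ Saturated
        continue zero i+1≡k = ⊥-elim (ℚ.<-irrefl refl
          (ℚ.<-≤-trans (subst (_< δ A′) (trans (cong (_· ε) (trans (ℕ.+-comm 1 i) i+1≡k)) k·ε≡t) 1+iε<A′)
                       (minCut≤t D′⊆S ∣D′∣≤k minA′)))
        continue (suc f) i+f≡k =
          greedy f (suc i) (trans (sym (ℕ.+-suc i (suc f))) i+f≡k) D′⊆S ∣D′∣≤1+i minA′ (ℚ.<⇒≤ 1+iε<A′)

      saturated : .{{_ : NonZero k}} → ∃ Saturated
      saturated =
        let A , minA = minCut ⊥ ∉⊥
        in greedy (ℕ.pred k) 0 (ℕ.suc-pred k) (λ v∈⊥ → contradiction v∈⊥ ∉⊥)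
             (ℕ.≤-reflexive (∣⊥∣≡0 n)) minA (weight-nonNeg 0≤w (crossings A))

      enlargement : ∀ {A} → Saturated A → ∀ v → ∃ λ B → Enlarges ε A B × (v ∈ S → v ∈ B)
      enlargement {A} ((_ , r∉A , _) , _ , enlarge) v with v ∈? S
      -- Vertices outside `S` get `A` itself as a default, so the family can be indexed by all
      -- vertices.
      ... | no  v∉S = A , (id , r∉A , ℚ.≤-trans (p≤q+p 0≤ε) (ℚ.≤-reflexive (ℚ.+-comm ε (δ A)))) ,
                      λ v∈S → contradiction v∈S v∉S
      ... | yes v∈S with B , v∈B , enlarges ← enlarge v v∈S = B , enlarges , λ _ → v∈B

      IrredundantCover : Subset n → Set
      IrredundantCover A =
        ∃ λ q → Σ (Family q n) λ B → (∀ i → Enlarges ε A (B i)) × S ⊆ cover A B ×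
          (∀ i → ∃ λ v → v ∈ S × v ∈ privatePart A B i)

      irredundantCover : ∀ {A} → Saturated A → IrredundantCover A
      irredundantCover {A} sat
        with q , B , enlarges , covers , private′ ←
          -- Covering only the terminals outside `A` makes each private vertex avoid `A`, as
          -- membership in `privatePart` requires.
          irredundant (S ∩ ∁ A) (Enlarges ε A) n (λ v → proj₁ (enlargement sat v))
            (λ v → proj₁ (proj₂ (enlargement sat v)))
            (λ v v∈Y → v , proj₂ (proj₂ (enlargement sat v)) (proj₁ (x∈p∩q⁻ S _ v∈Y)))
        = q , B , enlarges , S⊆cover , privateTerminal
        where
        S⊆cover : S ⊆ cover A B
        S⊆cover {v} v∈S with v ∈? A
        ... | yes v∈A = ⊆cover A B v∈A
        ... | no  v∉A with i , v∈Bᵢ ← covers v (x∈p∩q⁺ (v∈S , x∉p⇒x∈∁p v∉A)) = member⊆cover A B i v∈Bᵢ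
        privateTerminal : ∀ i → ∃ λ v → v ∈ S × v ∈ privatePart A B i
        privateTerminal i with v , v∈Y , priv ← private′ i with v∈S , v∈∁A ← x∈p∩q⁻ S _ v∈Y =
          v , v∈S , private∈privatePart A B (x∈∁p⇒x∉p v∈∁A) priv

-- Numerical facts on `k` and `β`.

n·1/k≡n/k : ∀ a k .{{_ : NonZero k}} → a · ((+ 1) / k) ≡ (+ a) / k
n·1/k≡n/k zero    (suc k) = sym (ℚ.0/n≡0 (suc k))
n·1/k≡n/k (suc a) (suc k) = trans (cong (_+_ ((+ 1) / suc k)) (n·1/k≡n/k a (suc k)))
  (ℚ.toℚᵘ-injective (begin-equality
  toℚᵘ (fromℚᵘ x + fromℚᵘ y)             ≃⟨ ℚ.toℚᵘ-homo-+ (fromℚᵘ x) (fromℚᵘ y) ⟩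
  toℚᵘ (fromℚᵘ x) ℚᵘ.+ toℚᵘ (fromℚᵘ y)   ≃⟨ ℚᵘ.+-cong (ℚ.toℚᵘ-fromℚᵘ x) (ℚ.toℚᵘ-fromℚᵘ y) ⟩
  x ℚᵘ.+ y                               ≃⟨ ℚᵘ.*≡* (solve 2 (λ a d →
                                              (con (+ 1) :* d :+ a :* d) :* d := (con (+ 1) :+ a) :* (d :* d))
                                              refl (+ a) (+ suc k)) ⟩
  ℚᵘ.mkℚᵘ (+ suc a) k                    ≃⟨ ℚ.toℚᵘ-fromℚᵘ (ℚᵘ.mkℚᵘ (+ suc a) k) ⟨
  toℚᵘ (fromℚᵘ (ℚᵘ.mkℚᵘ (+ suc a) k))    ∎))
  where
  open ℚᵘ.≤-Reasoning
  open ℤ.+-*-Solver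
  x = ℚᵘ.mkℚᵘ (+ 1) k
  y = ℚᵘ.mkℚᵘ (+ a) k

k·1/k≡1 : ∀ k .{{_ : NonZero k}} → k · ((+ 1) / k) ≡ 1ℚ
k·1/k≡1 (suc k) = trans (n·1/k≡n/k (suc k) (suc k))
  (ℚ.fromℚᵘ-cong {ℚᵘ.mkℚᵘ (+ suc k) k} {ℚᵘ.1ℚᵘ} (ℚᵘ.*≡* (ℤ.*-comm (+ suc k) (+ 1))))

1≤eSum : ∀ N → 1ℚ ≤ eSum N
1≤eSum zero    = ℚ.≤-refl
1≤eSum (suc N) = ℚ.≤-trans (1≤eSum N) (ℚ.≤-trans (p≤q+p 0≤1/N!) (ℚ.≤-reflexive (ℚ.+-comm _ (eSum N))))
  where
  0≤1/N! : 0ℚ ≤ ((+ 1) / (suc N !)) {{suc N !≢0}}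
  0≤1/N! = ℚ.nonNegative⁻¹ _ {{ℚ.normalize-nonNeg 1 (suc N !) {{suc N !≢0}}}}

-- With `s = eSum N` at least 1, `β` below 10 would give `10 s ≤ 10 (s - 1)`.
10≤β : ∀ {β} → BetaCondition β → (+ 10 / 1) ≤ β
10≤β {β} (N , h) = decidable-stable (+ 10 / 1 ℚ.≤? β) λ 10≰β →
  let s = eSum N
      0≤s-1 : 0ℚ ≤ s - 1ℚ
      0≤s-1 = subst (_≤ s - 1ℚ) (ℚ.+-inverseʳ 1ℚ) (ℚ.+-monoˡ-≤ (- 1ℚ) (1≤eSum N))
      s≤s-1 : s ≤ s - 1ℚ
      s≤s-1 = ℚ.*-cancelˡ-≤-pos (+ 10 / 1) (ℚ.≤-trans h
        (ℚ.*-monoʳ-≤-nonNeg (s - 1ℚ) {{nonNegative 0≤s-1}} (ℚ.<⇒≤ (ℚ.≰⇒> 10≰β))))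
  in ℚ.<-irrefl refl (ℚ.≤-<-trans s≤s-1
       (subst (s - 1ℚ <_) (ℚ.+-identityʳ s) (ℚ.+-monoʳ-< s (toWitness {a? = - 1ℚ ℚ.<? 0ℚ} _))))

halve-≤ : ∀ {x y} → x + x ≤ y + y → x ≤ y
halve-≤ {x} {y} h = decidable-stable (x ℚ.≤? y) λ x≰y →
  ℚ.<-irrefl refl (ℚ.<-≤-trans (ℚ.+-mono-< (ℚ.≰⇒> x≰y) (ℚ.≰⇒> x≰y)) h)

-- Splitting costs between the two stages.

module Stages {m} (c : Fin m → ℚ) (0≤c : ∀ e → 0ℚ ≤ c e) (E₀ : Subset m) where

  -- First-stage edges are given weight zero in `second` instead of being deleted, so all cuts live
  -- in the same graph.
  first second : Fin m → ℚ
  first  e = if lookup E₀ e then c e else 0ℚ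
  second e = if lookup E₀ e then 0ℚ else c e

  0≤first : ∀ e → 0ℚ ≤ first e
  0≤first e with lookup E₀ e
  ... | true  = 0≤c e
  ... | false = ℚ.≤-refl

  0≤second : ∀ e → 0ℚ ≤ second e
  0≤second e with lookup E₀ e
  ... | true  = ℚ.≤-refl
  ... | false = 0≤c e

  weight-split : ∀ f → weight c f ≡ weight second f + weight first f
  weight-split f = trans (sum-cong-≗ (λ e → trans (cong (f e ·_) (split e)) (×-distrib-+ (second e) (first e) (f e))))
                         (∑-distrib-+ (λ e → f e · second e) _)
    where
    split : ∀ e → c e ≡ second e + first e
    split e with lookup E₀ e
    ... | true  = sym (ℚ.+-identityˡ (c e))
    ... | false = sym (ℚ.+-identityʳ (c e))

  weight-first-≤ : ∀ {f} → (∀ e → f e ℕ.≤ 1) → weight first f ≤ cost c E₀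
  weight-first-≤ f≤1 = ℚ.≤-trans (weight-mono-≤ 0≤first f≤1)
    (ℚ.≤-reflexive (trans (sum-cong-≗ indicator) (sym (cost≡weight c E₀))))
    where
    indicator : ∀ e → 1 · first e ≡ bit (lookup E₀ e) · c e
    indicator e with lookup E₀ e
    ... | true  = refl
    ... | false = refl

  weight-first-≤2 : ∀ {f} → (∀ e → f e ℕ.≤ 2) → weight first f ≤ cost c E₀ + cost c E₀
  weight-first-≤2 f≤2 = ℚ.≤-trans (weight-mono-≤ 0≤first f≤2)
    (ℚ.≤-trans (ℚ.≤-reflexive (weight-+ {w = first} (λ _ → 1) (λ _ → 1)))
      (ℚ.+-mono-≤ (weight-first-≤ (λ _ → ℕ.≤-refl)) (weight-first-≤ (λ _ → ℕ.≤-refl))))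

  -- A selected edge lies in `E₀ ∪ F`; if it is in `E₀` it weighs nothing, and otherwise it is paid
  -- for by `F`.
  weight-second-≤ : ∀ F (b : Fin m → Bool) → (∀ e → lookup (E₀ ∪ F) e ≡ false → b e ≡ false) →
    weight second (bit ∘ b) ≤ cost c F
  weight-second-≤ F b h = ℚ.≤-trans (sum-mono-≤ term) (ℚ.≤-reflexive (sym (cost≡weight c F)))
    where
    term : ∀ e → bit (b e) · second e ≤ bit (lookup F e) · c e
    term e with lookup E₀ e | lookup F e | b e | h e ∘ trans (lookup-∪ E₀ F e)
    ... | true  | f     | true  | _  = ·-nonNeg (bit f) (0≤c e)
    ... | true  | f     | false | _  = ·-nonNeg (bit f) (0≤c e)
    ... | false | true  | true  | _  = ℚ.≤-refl
    ... | false | true  | false | _  = ·-nonNeg 1 (0≤c e)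
    ... | false | false | false | _  = ℚ.≤-refl
    ... | false | false | true  | h′ = contradiction (h′ refl) λ ()

-- Assembling the separating set and its cost bound.

mainTheorem8 : ∀ {n m : ℕ} (G : Graph n m) (c : Fin m → ℚ) (r : Fin n) (U : Subset n)
    (λ' : ℚ) (k : ℕ) .{{_ : NonZero k}} →
    (∀ e → 0ℚ ≤ c e) → 1ℚ ≤ λ' → k ℕ.≤ ∣ U ∣ →
    (E₀ : Subset m) (E : Subset n → Subset m) →
    Optimal G c r U k λ' (E₀ , E) →
    (β T : ℚ) → BetaCondition β → secondStage c U k E ≤ T →
    (S : Subset n) →
    (∀ v → v ∈ S → v ∈ U ×
    (∀ F → Separates G r F (Data.Fin.Subset.⁅ v ⁆) → β * T * ((+ 1) / k) ≤ cost c F)) →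
    (∀ v → v ∈ U →
    (∀ F → Separates G r F (Data.Fin.Subset.⁅ v ⁆) → β * T * ((+ 1) / k) ≤ cost c F) →
    v ∈ S) →
    Σ (Subset m) (λ F → Separates G r F S ×
    cost c F ≤ (+ 3 / 1) * cost c E₀ + β * ((+ 1) / 2) * secondStage c U k E)
mainTheorem8 {n} {m} G c r U λ' k@(suc k-1) 0≤c _ k≤U E₀ E (feasible , _) β T βcond t≤T S hard _ =
  conclude (proj₂ Seed.saturated) (Seed.irredundantCover (proj₂ Seed.saturated))
  where
  open Boundary G
  open Stages c 0≤c E₀
  open Cuts r second 0≤second
  open ℚ.≤-Reasoning
  open ℚ.+-*-Solver

  t = secondStage c U k E
  κ = (+ 1) / k
  ε = t * κ
  τ = β * T * κ
  Φ = cost c E₀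

  0≤t : 0ℚ ≤ t
  0≤t = secondStage-nonNeg c U k E

  0≤Φ : 0ℚ ≤ Φ
  0≤Φ = ℚ.≤-trans (weight-nonNeg 0≤c (bit ∘ lookup E₀)) (ℚ.≤-reflexive (sym (cost≡weight c E₀)))

  instance
    nonNeg-κ : NonNegative κ
    nonNeg-κ = ℚ.normalize-nonNeg 1 k

  0≤ε : 0ℚ ≤ ε
  0≤ε = subst (_≤ ε) (ℚ.*-zeroˡ κ) (ℚ.*-monoʳ-≤-nonNeg κ 0≤t)

  k·ε≡t : k · ε ≡ t
  k·ε≡t = trans (·-* k t κ) (trans (cong (t *_) (k·1/k≡1 k)) (ℚ.*-identityʳ t))

  3≤β : 1ℚ + 1ℚ + 1ℚ ≤ β
  3≤β = ℚ.≤-trans (toWitness {a? = 1ℚ + 1ℚ + 1ℚ ℚ.≤? + 10 / 1} _) (10≤β {β} βcond)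

  nonNeg-β : NonNegative β
  nonNeg-β = nonNegative (ℚ.≤-trans (toWitness {a? = 0ℚ ℚ.≤? 1ℚ + 1ℚ + 1ℚ} _) 3≤β)

  2≤β/2 : 1ℚ + 1ℚ ≤ β * ((+ 1) / 2)
  2≤β/2 = ℚ.≤-trans (toWitness {a? = 1ℚ + 1ℚ ℚ.≤? (+ 10 / 1) * ((+ 1) / 2)} _)
    (ℚ.*-monoʳ-≤-nonNeg ((+ 1) / 2) (10≤β {β} βcond))

  -- Of the three copies of `ε` per private part, one is lost to the growth of the potential; the
  -- other two yield `N ≤ t + Φ` after halving.
  3ε≤τ : ε + ε + ε ≤ τ
  3ε≤τ = begin
    ε + ε + ε            ≡⟨ solve 1 (λ e → e :+ e :+ e := (con 1ℚ :+ con 1ℚ :+ con 1ℚ) :* e) refl ε ⟩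
    (1ℚ + 1ℚ + 1ℚ) * ε   ≤⟨ ℚ.*-monoʳ-≤-nonNeg ε {{nonNegative 0≤ε}} 3≤β ⟩
    β * ε                ≡⟨ ℚ.*-assoc β t κ ⟨
    β * t * κ            ≤⟨ ℚ.*-monoʳ-≤-nonNeg κ (ℚ.*-monoˡ-≤-nonNeg β {{nonNeg-β}} t≤T) ⟩
    τ                    ∎

  cheap : ∀ D → D ⊆ S → ∣ D ∣ ℕ.≤ k → ¬ ¬ ∃ λ X → D ⊆ X × r ∉ X × δ X ≤ t
  cheap D D⊆S ∣D∣≤k no-cut
    with D′ , D⊆D′ , D′⊆U , ∣D′∣≡k ←
      intermediateSubset D U k (λ {v} v∈D → proj₁ (hard v (D⊆S v∈D))) ∣D∣≤k k≤U =
    -- The scenario's separator `E₀ ∪ E D′` gives a cut whose edges outside `E₀` all belong to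
    -- `E D′`, hence cost at most `t`.
    separator⇒cut D′ (feasible D′ D′⊆U ∣D′∣≡k) λ (X , D′⊆X , r∉X , uncut) →
      no-cut (X , D′⊆X ∘ D⊆D′ , r∉X ,
        ℚ.≤-trans (weight-second-≤ (E D′) (λ e → cuts X (end₁ G e) (end₂ G e)) uncut)
                  (cost≤secondStage c U k E D′ D′⊆U ∣D′∣≡k))

  module Seed = Greedy S k t ε 0≤ε k·ε≡t cheap

  Conclusion : Set
  Conclusion = Σ (Subset m) (λ F → Separates G r F S ×
    cost c F ≤ (+ 3 / 1) * Φ + β * ((+ 1) / 2) * t)

  conclude : ∀ {A} → Seed.Saturated A → Seed.IrredundantCover A → Conclusion
  conclude {A} (minA , A≤t , _) (q , B , enlarges , S⊆cover , private-terminal)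
    -- The boundary is taken in all of `G`; its first-stage edges add at most `Φ` to the `δ` bound.
    = boundary (cover A B) , boundary-separates (cover A B) S (r∉cover B r∉B) S⊆cover , (begin
      cost c (boundary (cover A B))    ≡⟨ cost-boundary c (cover A B) ⟩
      cutWeight c (cover A B)          ≡⟨ weight-split (crossings (cover A B)) ⟩
      δ (cover A B) + weight first (crossings (cover A B))
                                       ≤⟨ ℚ.+-mono-≤ (cover-≤ B enlarges)
                                            (weight-first-≤ (λ e → bit≤1 (cuts (cover A B) _ _))) ⟩
      δ A + N + Φ                      ≤⟨ ℚ.+-monoˡ-≤ Φ (ℚ.+-mono-≤ A≤t N≤t+Φ) ⟩
      t + (t + Φ) + Φ                  ≡⟨ solve 2 (λ t Φ → t :+ (t :+ Φ) :+ Φ :=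
                                            (con 1ℚ :+ con 1ℚ) :* Φ :+ (con 1ℚ :+ con 1ℚ) :* t) refl t Φ ⟩
      (1ℚ + 1ℚ) * Φ + (1ℚ + 1ℚ) * t    ≤⟨ ℚ.+-mono-≤
                                            (ℚ.*-monoʳ-≤-nonNeg Φ {{nonNegative 0≤Φ}}
                                              (toWitness {a? = 1ℚ + 1ℚ ℚ.≤? + 3 / 1} _))
                                            (ℚ.*-monoʳ-≤-nonNeg t {{nonNegative 0≤t}} 2≤β/2) ⟩
      (+ 3 / 1) * Φ + β * ((+ 1) / 2) * t   ∎)
    where
    open Uncross {ε} minA

    N = q · ε

    r∉B : ∀ i → r ∉ B i
    r∉B = proj₁ ∘ proj₂ ∘ enlarges

    P : Family q n
    P = privatePart A B

    τ≤P : ∀ i → τ ≤ cutWeight c (P i)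
    -- The part contains a terminal of `S` and avoids `r`, so its boundary separates that terminal
    -- and costs at least `τ` under `c`.
    τ≤P i = let v , v∈S , v∈P = private-terminal i in ℚ.≤-trans
      (proj₂ (hard v v∈S) (boundary (P i)) (boundary-separates (P i) ⁅ v ⁆ (r∉B i ∘ proj₁ ∘ x∈p∩q⁻ (B i) _)
        (λ x∈v → subst (_∈ P i) (sym (x∈⁅y⁆⇒x≡y v x∈v)) v∈P)))
      (ℚ.≤-reflexive (cost-boundary c (P i)))

    crossingsP : Fin m → ℕ
    crossingsP e = sumℕ (λ i → crossings (P i) e)

    N≤t+Φ : N ≤ t + Φ
    N≤t+Φ = halve-≤ (+-cancelʳ-≤ N (begin
      N + N + N                                     ≡⟨ trans (×-distrib-+ (ε + ε) ε q) (cong (_+ N) (×-distrib-+ ε ε q)) ⟨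
      q · (ε + ε + ε)                               ≤⟨ ·-monoʳ-≤ q 3ε≤τ ⟩
      q · τ                                         ≤⟨ ·≤weight-sum (λ i → crossings (P i)) τ≤P ⟩
      weight c crossingsP                           ≡⟨ weight-split crossingsP ⟩
      weight second crossingsP + weight first crossingsP
        -- Second-stage weight is charged to the potential; each first-stage edge crosses at most
        -- two private parts, hence `Φ + Φ`.
        ≤⟨ ℚ.+-mono-≤
               (ℚ.≤-trans
                 (weight-mono-≤ 0≤second (λ e → private-sum≤Potential A B (end₁ G e) (end₂ G e)))
                 (potentialWeight-≤ B enlarges))
               (weight-first-≤2 (λ e → private-sum≤2 A B (end₁ G e) (end₂ G e))) ⟩
      δ A + δ A + N + (Φ + Φ)                       ≤⟨ ℚ.+-monoˡ-≤ (Φ + Φ) (ℚ.+-monoˡ-≤ N (ℚ.+-mono-≤ A≤t A≤t)) ⟩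
      t + t + N + (Φ + Φ)                           ≡⟨ solve 3 (λ t N Φ → t :+ t :+ N :+ (Φ :+ Φ) := t :+ Φ :+ (t :+ Φ) :+ N)
                                                         refl t N Φ ⟩
      t + Φ + (t + Φ) + N                           ∎))
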